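{- Let $P(x)=x^3+k_2x+k_3$ be a real polynomial with $P(x)\neq x^3$. Then $P(x)$ is $\mathcal{R}$ if and only if $P(x)$ is $\mathcal{IR}$.
   Context: A monic real polynomial $P(x)$ of degree $n$ is realizable ($\mathcal{R}$) if it is the characteristic polynomial of some $n\times n$ entrywise nonnegative matrix; it is irreducibly realizable ($\mathcal{IR}$) if it is the characteristic polynomial of some $n\times n$ irreducible entrywise nonnegative matrix. A square matrix is irreducible if it is not similar by a permutation matrix to a nontrivially block triangular matrix (equivalently, its digraph is strongly connected). -}

module Defs where

open import Algebra.Bundles using (CommutativeRing)
open import Algebra.Bundles.Raw using (RawRing)
import Algebra.Definitions.RawSemiring as RawSemiringDefs
open import Data.Bool.Base using (if_then_else_)
open import Data.Fin.Base using (Fin; zero; suc; toℕ)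
open import Data.Fin.Permutation using (Permutation′; _⟨$⟩ʳ_)
open import Data.Fin.Properties using (_≟_)
open import Data.List.Base as List using (List; []; _∷_)
open import Data.Nat.Base as ℕ using (ℕ; zero; suc)
open import Data.Product.Base using (∃; ∃-syntax; _×_)
open import Data.Vec.Functional using (Vector; removeAt)
open import Level using (Level; _⊔_) renaming (suc to lsuc)
open import Relation.Binary.Core using (Rel)
open import Relation.Binary.Structures using (IsDecTotalOrder)
open import Relation.Nullary using (¬_; does)
open import Relation.Unary using (Pred; _∈_; Satisfiable)

-- The real numbers, given by their usual classical axioms (which determine
-- them up to isomorphism): a totally ordered field in which every nonempty
-- set that is bounded above has a least upper bound.  As classically, the
-- order is total and equality is decided.
record CompleteOrderedField (c ℓ₁ ℓ₂ : Level) : Set (lsuc (c ⊔ ℓ₁ ⊔ ℓ₂)) where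
  infix 4 _≤_
  field
    commutativeRing : CommutativeRing c ℓ₁

  open CommutativeRing commutativeRing public

  field
    0≉1     : 0# ≉ 1#
    inverse : ∀ x → x ≉ 0# → ∃[ y ] x * y ≈ 1#

    _≤_             : Rel Carrier ℓ₂
    isDecTotalOrder : IsDecTotalOrder _≈_ _≤_
    +-monoˡ-≤       : ∀ {x y} z → x ≤ y → x + z ≤ y + z
    *-nonNeg        : ∀ {x y} → 0# ≤ x → 0# ≤ y → 0# ≤ x * y

  IsUpperBound : Pred Carrier (c ⊔ ℓ₁ ⊔ ℓ₂) → Carrier → Set (c ⊔ ℓ₁ ⊔ ℓ₂)
  IsUpperBound S b = ∀ {x} → x ∈ S → x ≤ b

  field
    supremum : ∀ S → Satisfiable S → ∃ (IsUpperBound S) →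
               ∃[ s ] IsUpperBound S s × (∀ b → IsUpperBound S b → s ≤ b)

Matrix : ∀ {a} → Set a → ℕ → Set a
Matrix A n = Vector (Vector A n) n

-- Laplace expansion along the first row.
module Determinant {c ℓ} (R : RawRing c ℓ) where
  open RawRing R
  open RawSemiringDefs rawSemiring using (sum; _^_)

  det : ∀ {n} → Matrix Carrier n → Carrier
  det {zero}  A = 1#
  det {suc n} A = sum λ j →
    (- 1#) ^ toℕ j * (A zero j * det (λ i → removeAt (A (suc i)) j))

-- A polynomial is a list of coefficients, constant term first.  Trailing
-- zeros are allowed, so equality is equality of all coefficients.
module Polynomial {c ℓ} (R : RawRing c ℓ) where
  open RawRing R

  Poly : Set c
  Poly = List Carrier

  coeff : Poly → ℕ → Carrier
  coeff []      _       = 0#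
  coeff (a ∷ p) zero    = a
  coeff (a ∷ p) (suc i) = coeff p i

  infix  4 _≈ᴾ_
  infixl 6 _+ᴾ_
  infixl 7 _*ᴾ_

  _≈ᴾ_ : Rel Poly ℓ
  p ≈ᴾ q = ∀ i → coeff p i ≈ coeff q i

  _+ᴾ_ : Poly → Poly → Poly
  []      +ᴾ q       = q
  (a ∷ p) +ᴾ []      = a ∷ p
  (a ∷ p) +ᴾ (b ∷ q) = (a + b) ∷ (p +ᴾ q)

  _*ᴾ_ : Poly → Poly → Poly
  []      *ᴾ q = []
  (a ∷ p) *ᴾ q = List.map (a *_) q +ᴾ (0# ∷ (p *ᴾ q))

  const : Carrier → Poly
  const a = a ∷ []

  X : Poly
  X = 0# ∷ 1# ∷ []

  rawRing : RawRing c ℓ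
  rawRing = record
    { Carrier = Poly
    ; _≈_     = _≈ᴾ_
    ; _+_     = _+ᴾ_
    ; _*_     = _*ᴾ_
    ; -_      = List.map (-_)
    ; 0#      = []
    ; 1#      = const 1#
    }

module Realizability {c ℓ₁ ℓ₂} (ℝ : CompleteOrderedField c ℓ₁ ℓ₂) where
  open CompleteOrderedField ℝ using (Carrier; _≈_; _≤_; 0#; commutativeRing) public

  private
    rawR : RawRing c ℓ₁
    rawR = CommutativeRing.rawRing commutativeRing

  open Polynomial rawR using (Poly; const; X) public
  polyRing : RawRing c ℓ₁
  polyRing = Polynomial.rawRing rawR

  module P = RawRing polyRing
  open RawSemiringDefs P.rawSemiring using (_^_) public

  open Determinant polyRing using (det)

  -- det (X I - A)
  charPoly : ∀ {n} → Matrix Carrier n → Poly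
  charPoly A = det λ i j →
    (if does (i ≟ j) then X else P.0#) P.+ (P.- const (A i j))

  Nonnegative : ∀ {n} → Matrix Carrier n → Set ℓ₂
  Nonnegative A = ∀ i j → 0# ≤ A i j

  -- If Q is the permutation matrix of σ with Q i (σ i) = 1, then
  -- Q A Qᵀ has entries A (σ i) (σ j).
  permute : ∀ {n} → Permutation′ n → Matrix Carrier n → Matrix Carrier n
  permute σ A i j = A (σ ⟨$⟩ʳ i) (σ ⟨$⟩ʳ j)

  -- Diagonal blocks of sizes k and n - k, both nonempty, with the block
  -- below the diagonal zero.
  BlockTriangular : ∀ {n} → Matrix Carrier n → Set ℓ₁
  BlockTriangular {n} A = ∃[ k ] 0 ℕ.< k × k ℕ.< n ×
    (∀ i j → k ℕ.≤ toℕ i → toℕ j ℕ.< k → A i j ≈ 0#)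

  Irreducible : ∀ {n} → Matrix Carrier n → Set ℓ₁
  Irreducible {n} A = ¬ (∃[ σ ] BlockTriangular (permute {n} σ A))

  -- The characteristic polynomial of an n × n matrix is monic of degree n,
  -- so n is necessarily the degree of p in the next two definitions.
  Realizable : ℕ → Poly → Set (c ⊔ ℓ₁ ⊔ ℓ₂)
  Realizable n p = ∃[ A ] Nonnegative {n} A × charPoly A P.≈ p

  IrreduciblyRealizable : ℕ → Poly → Set (c ⊔ ℓ₁ ⊔ ℓ₂)
  IrreduciblyRealizable n p =
    ∃[ A ] Nonnegative {n} A × Irreducible A × charPoly A P.≈ p

  depressedCubic : Carrier → Carrier → Poly
  depressedCubic k₂ k₃ = X ^ 3 P.+ const k₂ P.* X P.+ const k₃

{-# OPTIONS --safe #-}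
-- A nonnegative matrix of trace 0 has zero diagonal, so its characteristic
-- polynomial is x³ − p x − q, where p ≥ 0 sums the weights of the 2-cycles and
-- q ≥ 0 those of the 3-cycles of its digraph.  Conversely, with p = h + h, the
-- nonnegative matrix
--   0 1 0
--   h 0 1
--   q h 0
-- has this characteristic polynomial.  A reducible 3 × 3 matrix has a row or a
-- column without nonzero off-diagonal entries; here this forces h = q = 0.
module Submission where

open import Defs

open import Algebra.Bundles using (CommutativeRing)
open import Algebra.Bundles.Raw using (RawRing)
import Algebra.Properties.CommutativeSemigroup as CommutativeSemigroupProperties
import Algebra.Properties.Ring as RingProperties
import Algebra.Properties.Semiring.Mult.TCOptimised as Multiples
import Algebra.Solver.Ring as RingSolver
open import Algebra.Solver.Ring.AlmostCommutativeRing
  using (fromCommutativeRing; _-Raw-AlmostCommutative⟶_; Induced-equivalence)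
open import Data.Bool.Base using (T; if_then_else_)
open import Data.Fin.Base using (Fin; suc; toℕ; combine)
open import Data.Fin.Patterns using (0F; 1F; 2F)
open import Data.Fin.Permutation using (Permutation′; _⟨$⟩ʳ_; _⟨$⟩ˡ_; inverseʳ)
open import Data.Fin.Properties using (_≟_)
open import Data.List.Base using ([])
open import Data.Maybe.Base as Maybe using (just; is-just)
open import Data.Nat.Base as ℕ using (ℕ; zero; suc; z≤n; s≤s)
import Data.Nat.Properties as ℕ
open import Data.Product.Base using (∃-syntax; _×_; _,_; proj₁; proj₂)
open import Data.Product.Properties using (≡-dec)
open import Data.Sum.Base using (_⊎_; inj₁; inj₂)
open import Data.Vec.Base using (Vec; []; _∷_)
open import Function.Base using (_∘_)
open import Function.Bundles using (_⇔_; mk⇔)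
open import Relation.Binary.Definitions using (WeaklyDecidable)
open import Relation.Binary.PropositionalEquality as ≡ using (_≡_; _≢_)
import Relation.Binary.Reasoning.Setoid as ≈-Reasoning
open import Relation.Binary.Structures using (IsDecTotalOrder)
open import Relation.Nullary using (¬_; does; contradiction)
open import Relation.Nullary.Decidable using (dec⇒maybe)

-- Ring solver with integer constants.

-- The pair (m , n) stands for the integer m − n.  Pairs are compared without
-- cancelling: this suffices for identities in which no monomial occurs with
-- both signs, as is the case for a generic determinant.
module DifferenceSolver {c ℓ} (R : CommutativeRing c ℓ) where
  open CommutativeRing R hiding (zero)
  open RingProperties ring
  open CommutativeSemigroupProperties +-commutativeSemigroup using (interchange)
  open Multiples semiring using (×-homo-+; ×1-homo-*) renaming (_×_ to _·_)
  open ≈-Reasoning setoid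

  differences : RawRing _ _
  differences = record
    { Carrier = ℕ × ℕ
    ; _≈_     = _≡_
    ; _+_     = λ (a , b) (c , d) → a ℕ.+ c , b ℕ.+ d
    ; _*_     = λ (a , b) (c , d) → a ℕ.* c ℕ.+ b ℕ.* d , a ℕ.* d ℕ.+ b ℕ.* c
    ; -_      = λ (a , b) → b , a
    ; 0#      = 0 , 0
    ; 1#      = 1 , 0
    }

  private module D = RawRing differences

  -- The first clause makes the constants 0 and 1 evaluate to 0# and 1# themselves.
  ⟦_⟧ᴰ : ℕ × ℕ → Carrier
  ⟦ m , zero  ⟧ᴰ = m · 1#
  ⟦ m , suc n ⟧ᴰ = m · 1# - suc n · 1#

  -- Removes the case split in `⟦_⟧ᴰ`, so that the homomorphism laws below reduce to identities
  -- between differences.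
  ⟦⟧-difference : ∀ p → ⟦ p ⟧ᴰ ≈ proj₁ p · 1# - proj₂ p · 1#
  ⟦⟧-difference (m , zero)  = sym (trans (+-congˡ -0#≈0#) (+-identityʳ _))
  ⟦⟧-difference (m , suc n) = refl

  +-difference : ∀ a b c d → (a - b) + (c - d) ≈ (a + c) - (b + d)
  +-difference a b c d = trans (interchange a (- b) c (- d)) (+-congˡ (-‿+-comm b d))

  *-difference : ∀ a b c d → (a - b) * (c - d) ≈ (a * c + b * d) - (a * d + b * c)
  *-difference a b c d = begin
    (a - b) * (c - d)                        ≈⟨ [y-z]x≈yx-zx (c - d) a b ⟩
    a * (c - d) - b * (c - d)                ≈⟨ +-cong (x[y-z]≈xy-xz a c d) (-‿cong (x[y-z]≈xy-xz b c d)) ⟩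
    (a * c - a * d) - (b * c - b * d)        ≈⟨ +-congˡ (⁻¹-anti-homo‿- (b * c) (b * d)) ⟩
    (a * c - a * d) + (b * d - b * c)        ≈⟨ +-difference (a * c) (a * d) (b * d) (b * c) ⟩
    (a * c + b * d) - (a * d + b * c)        ∎

  -- Both components of a product of pairs have this shape.
  ·1-homo-*+* : ∀ k l m n → (k ℕ.* l ℕ.+ m ℕ.* n) · 1# ≈ k · 1# * l · 1# + m · 1# * n · 1#
  ·1-homo-*+* k l m n =
    trans (×-homo-+ 1# (k ℕ.* l) (m ℕ.* n)) (+-cong (×1-homo-* k l) (×1-homo-* m n))

  ⟦⟧-+-homo : ∀ p q → ⟦ p D.+ q ⟧ᴰ ≈ ⟦ p ⟧ᴰ + ⟦ q ⟧ᴰ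
  ⟦⟧-+-homo p@(a , b) q@(c , d) = begin
    ⟦ p D.+ q ⟧ᴰ                             ≈⟨ ⟦⟧-difference (p D.+ q) ⟩
    (a ℕ.+ c) · 1# - (b ℕ.+ d) · 1#          ≈⟨ +-cong (×-homo-+ 1# a c) (-‿cong (×-homo-+ 1# b d)) ⟩
    (a · 1# + c · 1#) - (b · 1# + d · 1#)    ≈⟨ +-difference _ _ _ _ ⟨
    (a · 1# - b · 1#) + (c · 1# - d · 1#)    ≈⟨ +-cong (⟦⟧-difference p) (⟦⟧-difference q) ⟨
    ⟦ p ⟧ᴰ + ⟦ q ⟧ᴰ                          ∎

  ⟦⟧-*-homo : ∀ p q → ⟦ p D.* q ⟧ᴰ ≈ ⟦ p ⟧ᴰ * ⟦ q ⟧ᴰ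
  ⟦⟧-*-homo p@(a , b) q@(c , d) = begin
    ⟦ p D.* q ⟧ᴰ                             ≈⟨ ⟦⟧-difference (p D.* q) ⟩
    _ - _                                    ≈⟨ +-cong (·1-homo-*+* a c b d) (-‿cong (·1-homo-*+* a d b c)) ⟩
    _ - _                                    ≈⟨ *-difference _ _ _ _ ⟨
    (a · 1# - b · 1#) * (c · 1# - d · 1#)    ≈⟨ *-cong (⟦⟧-difference p) (⟦⟧-difference q) ⟨
    ⟦ p ⟧ᴰ * ⟦ q ⟧ᴰ                          ∎

  ⟦⟧-‿homo : ∀ p → ⟦ D.- p ⟧ᴰ ≈ - ⟦ p ⟧ᴰ
  ⟦⟧-‿homo p@(a , b) = begin
    ⟦ b , a ⟧ᴰ             ≈⟨ ⟦⟧-difference (b , a) ⟩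
    b · 1# - a · 1#        ≈⟨ ⁻¹-anti-homo‿- _ _ ⟨
    - (a · 1# - b · 1#)    ≈⟨ -‿cong (⟦⟧-difference p) ⟨
    - ⟦ p ⟧ᴰ               ∎

  ⟦⟧-morphism : differences -Raw-AlmostCommutative⟶ fromCommutativeRing R
  ⟦⟧-morphism = record
    { ⟦_⟧    = ⟦_⟧ᴰ
    ; +-homo = ⟦⟧-+-homo
    ; *-homo = ⟦⟧-*-homo
    ; -‿homo = ⟦⟧-‿homo
    ; 0-homo = refl
    ; 1-homo = refl
    }

  _≈ᴰ?_ : WeaklyDecidable (Induced-equivalence ⟦⟧-morphism)
  p ≈ᴰ? q = Maybe.map (reflexive ∘ ≡.cong ⟦_⟧ᴰ) (dec⇒maybe (≡-dec ℕ._≟_ ℕ._≟_ p q))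

  open RingSolver differences (fromCommutativeRing R) ⟦⟧-morphism _≈ᴰ?_ public
    using (Polynomial; con; var; _:+_; _:*_; :-_; _:-_; ⟦_⟧; prove; normalise; _≟N_; ⟦_⟧N-cong)

  -- Comparing the normal forms by a Boolean test is much cheaper than letting
  -- the type checker unify their interpretations in R.
  solve-≈ : ∀ {n} (ρ : Vec Carrier n) (e₁ e₂ : Polynomial n) →
            {T (is-just (normalise e₁ ≟N normalise e₂))} → ⟦ e₁ ⟧ ρ ≈ ⟦ e₂ ⟧ ρ
  solve-≈ ρ e₁ e₂ with normalise e₁ ≟N normalise e₂
  ... | just e₁≈e₂ = prove ρ e₁ e₂ (⟦ e₁≈e₂ ⟧N-cong ρ)

  syntaxRing : ℕ → RawRing _ _
  syntaxRing n = record
    { Carrier = Polynomial n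
    ; _≈_     = _≡_
    ; _+_     = _:+_
    ; _*_     = _:*_
    ; -_      = :-_
    ; 0#      = con D.0#
    ; 1#      = con D.1#
    }

-- Over the ring of a CompleteOrderedField these agree definitionally with charPoly and
-- depressedCubic; over syntaxRing they produce the expressions fed to the solver.
module Generic {c ℓ} (R : RawRing c ℓ) where
  open RawRing R using (Carrier)
  open Polynomial R hiding (coeff)
  open Polynomial R public using (coeff)
  open Determinant rawRing using (det)

  characteristic : ∀ {n} → Matrix Carrier n → Poly
  characteristic A = det λ i j →
    (if does (i ≟ j) then X else []) +ᴾ RawRing.-_ rawRing (const (A i j))

  X³ : Poly
  X³ = X *ᴾ (X *ᴾ (X *ᴾ const (RawRing.1# R)))

  cubic : Carrier → Carrier → Poly
  cubic a b = X³ +ᴾ const a *ᴾ X +ᴾ const b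

  matrix₃ : (a b c d e f g h i : Carrier) → Matrix Carrier 3
  matrix₃ a b c d e f g h i 0F 0F = a
  matrix₃ a b c d e f g h i 0F 1F = b
  matrix₃ a b c d e f g h i 0F 2F = c
  matrix₃ a b c d e f g h i 1F 0F = d
  matrix₃ a b c d e f g h i 1F 1F = e
  matrix₃ a b c d e f g h i 1F 2F = f
  matrix₃ a b c d e f g h i 2F 0F = g
  matrix₃ a b c d e f g h i 2F 1F = h
  matrix₃ a b c d e f g h i 2F 2F = i

module _ {c ℓ₁ ℓ₂} (ℝ : CompleteOrderedField c ℓ₁ ℓ₂) where
  open CompleteOrderedField ℝ hiding (zero)
  open Realizability ℝ hiding (Carrier; _≈_; _≤_; 0#; commutativeRing)
  open Generic rawRing using (coeff; matrix₃)
  open DifferenceSolver commutativeRing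
  open RingProperties ring
  open IsDecTotalOrder isDecTotalOrder
    using (antisym; total; ≤-respˡ-≈; ≤-respʳ-≈)
    renaming (trans to ≤-trans; reflexive to ≤-reflexive)

  private
    module S n = Generic (syntaxRing n)

  -- Consequences of the order axioms.

  +-nonNeg : ∀ {x y} → 0# ≤ x → 0# ≤ y → 0# ≤ x + y
  +-nonNeg {x} {y} 0≤x 0≤y = ≤-trans 0≤y (≤-respˡ-≈ (+-identityˡ y) (+-monoˡ-≤ y 0≤x))

  -- Adding `x` to `0 ≤ y` squeezes `x` between 0 and `x + y`. This is how a zero trace forces a
  -- zero diagonal.
  nonNeg-sum≈0⇒≈0 : ∀ {x y} → 0# ≤ x → 0# ≤ y → x + y ≈ 0# → x ≈ 0# × y ≈ 0#
  nonNeg-sum≈0⇒≈0 {x} {y} 0≤x 0≤y x+y≈0 =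
    x≈0 , trans (sym (+-identityˡ y)) (trans (+-congʳ (sym x≈0)) x+y≈0)
    where
    x≈0 : x ≈ 0#
    x≈0 = antisym
      (≤-respʳ-≈ (trans (+-comm y x) x+y≈0) (≤-respˡ-≈ (+-identityˡ x) (+-monoˡ-≤ x 0≤y)))
      0≤x

  nonPos⇒neg-nonNeg : ∀ {x} → x ≤ 0# → 0# ≤ - x
  nonPos⇒neg-nonNeg {x} x≤0 =
    ≤-respˡ-≈ (-‿inverseʳ x) (≤-respʳ-≈ (+-identityˡ (- x)) (+-monoˡ-≤ (- x) x≤0))

  0≤1 : 0# ≤ 1#
  0≤1 with total 0# 1#
  ... | inj₁ 0≤1 = 0≤1
  -- If `1 ≤ 0`, then -1 is nonnegative, and hence so is its square 1.
  ... | inj₂ 1≤0 = ≤-respʳ-≈ (trans (-1*x≈-x (- 1#)) (-‿involutive 1#))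
                     (*-nonNeg (nonPos⇒neg-nonNeg 1≤0) (nonPos⇒neg-nonNeg 1≤0))

  1+1≉0 : 1# + 1# ≉ 0#
  1+1≉0 1+1≈0 = 0≉1 (sym (proj₁ (nonNeg-sum≈0⇒≈0 0≤1 0≤1 1+1≈0)))

  halve : ∀ {x} → 0# ≤ x → ∃[ h ] 0# ≤ h × h + h ≈ x
  halve {x} 0≤x with inverse (1# + 1#) 1+1≉0
  ... | ½ , 2*½≈1 = h , 0≤h , h+h≈x
    where
    open ≈-Reasoning setoid
    h = ½ * x

    h+h≈x : h + h ≈ x
    h+h≈x = begin
      h + h                  ≈⟨ +-cong (*-identityˡ h) (*-identityˡ h) ⟨
      1# * h + 1# * h        ≈⟨ distribʳ h 1# 1# ⟨
      (1# + 1#) * (½ * x)    ≈⟨ *-assoc (1# + 1#) ½ x ⟨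
      (1# + 1#) * ½ * x      ≈⟨ *-congʳ 2*½≈1 ⟩
      1# * x                 ≈⟨ *-identityˡ x ⟩
      x                      ∎

    0≤h : 0# ≤ h
    0≤h with total 0# h
    ... | inj₁ 0≤h = 0≤h
    -- Here `x`, being `h + h`, is at most `h`, so `0 ≤ x ≤ h` after all.
    ... | inj₂ h≤0 = ≤-trans 0≤x (≤-respˡ-≈ h+h≈x (≤-respʳ-≈ (+-identityˡ h) (+-monoˡ-≤ h h≤0)))

  -- Coefficients of the characteristic polynomial and of the depressed cubic.

  module _ (A : Matrix Carrier 3) where
    cycles₂ cycles₃ : Carrier
    cycles₂ = A 0F 1F * A 1F 0F + A 0F 2F * A 2F 0F + A 1F 2F * A 2F 1F
    cycles₃ = A 0F 1F * A 1F 2F * A 2F 0F + A 0F 2F * A 1F 0F * A 2F 1F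

    private
      entries : Vec Carrier 9
      entries = A 0F 0F ∷ A 0F 1F ∷ A 0F 2F ∷
                A 1F 0F ∷ A 1F 1F ∷ A 1F 2F ∷
                A 2F 0F ∷ A 2F 1F ∷ A 2F 2F ∷ []

      -- `combine i j` is the index `3 i + j`, matching the row-by-row order of `entries`.
      a : Matrix (Polynomial 9) 3
      a i j = var (combine i j)

      coeffˢ : ℕ → Polynomial 9
      coeffˢ = S.coeff 9 (S.characteristic 9 a)

    charPoly-coeff₂ : coeff (charPoly A) 2 ≈ - (A 0F 0F + (A 1F 1F + A 2F 2F))
    charPoly-coeff₂ = solve-≈ entries (coeffˢ 2) (:- (a 0F 0F :+ (a 1F 1F :+ a 2F 2F)))

    -- This is the sum of the principal 2 × 2 minors. The cyclic order gives each diagonal product a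
    -- different leading diagonal entry, as `diagonal-terms-vanish` expects.
    charPoly-coeff₁ : coeff (charPoly A) 1 ≈
      A 0F 0F * A 1F 1F + A 1F 1F * A 2F 2F + A 2F 2F * A 0F 0F - cycles₂
    charPoly-coeff₁ = solve-≈ entries (coeffˢ 1)
      (a 0F 0F :* a 1F 1F :+ a 1F 1F :* a 2F 2F :+ a 2F 2F :* a 0F 0F :-
        (a 0F 1F :* a 1F 0F :+ a 0F 2F :* a 2F 0F :+ a 1F 2F :* a 2F 1F))

    -- This is minus the determinant. The four permutations with a fixed point are grouped by a
    -- diagonal entry; the other two are the 3-cycles.
    charPoly-coeff₀ : coeff (charPoly A) 0 ≈
      A 0F 0F * (A 1F 2F * A 2F 1F - A 1F 1F * A 2F 2F) + A 1F 1F * (A 0F 2F * A 2F 0F) +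
      A 2F 2F * (A 0F 1F * A 1F 0F) - cycles₃
    charPoly-coeff₀ = solve-≈ entries (coeffˢ 0)
      (a 0F 0F :* (a 1F 2F :* a 2F 1F :- a 1F 1F :* a 2F 2F) :+ a 1F 1F :* (a 0F 2F :* a 2F 0F) :+
       a 2F 2F :* (a 0F 1F :* a 1F 0F) :-
        (a 0F 1F :* a 1F 2F :* a 2F 0F :+ a 0F 2F :* a 1F 0F :* a 2F 1F))

  depressedCubic-coeff₀ : ∀ a b → coeff (depressedCubic a b) 0 ≈ b
  depressedCubic-coeff₀ a b = solve-≈ (a ∷ b ∷ [])
    (S.coeff 2 (S.cubic 2 (var 0F) (var 1F)) 0) (var 1F)

  depressedCubic-coeff₁ : ∀ a b → coeff (depressedCubic a b) 1 ≈ a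
  depressedCubic-coeff₁ a b = solve-≈ (a ∷ b ∷ [])
    (S.coeff 2 (S.cubic 2 (var 0F) (var 1F)) 1) (var 0F)

  depressedCubic-coeff₂ : ∀ a b → coeff (depressedCubic a b) 2 ≈ 0#
  depressedCubic-coeff₂ a b = solve-≈ (a ∷ b ∷ [])
    (S.coeff 2 (S.cubic 2 (var 0F) (var 1F)) 2) (con (0 , 0))

  -- The polynomials are explicit because `P.≈` unfolds to equations between coefficients, from
  -- which they cannot be inferred.
  ≈ᴾ-trans : ∀ (p q r : Poly) → p P.≈ q → q P.≈ r → p P.≈ r
  ≈ᴾ-trans p q r p≈q q≈r i = trans (p≈q i) (q≈r i)

  depressedCubic-cong : ∀ {a b a′ b′} → a ≈ a′ → b ≈ b′ → depressedCubic a b P.≈ depressedCubic a′ b′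
  depressedCubic-cong {a} {b} {a′} {b′} a≈a′ b≈b′ 0 =
    trans (depressedCubic-coeff₀ a b) (trans b≈b′ (sym (depressedCubic-coeff₀ a′ b′)))
  depressedCubic-cong {a} {b} {a′} {b′} a≈a′ b≈b′ 1 =
    trans (depressedCubic-coeff₁ a b) (trans a≈a′ (sym (depressedCubic-coeff₁ a′ b′)))
  -- The parameters do not occur in the coefficients from degree 2 on.
  depressedCubic-cong a≈a′ b≈b′ (suc (suc i)) = refl

  depressedCubic-0-0 : depressedCubic 0# 0# P.≈ X ^ 3
  depressedCubic-0-0 0 = solve-≈ []
    (S.coeff 0 (S.cubic 0 (con (0 , 0)) (con (0 , 0))) 0) (S.coeff 0 (S.X³ 0) 0)
  depressedCubic-0-0 1 = solve-≈ []
    (S.coeff 0 (S.cubic 0 (con (0 , 0)) (con (0 , 0))) 1) (S.coeff 0 (S.X³ 0) 1)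
  depressedCubic-0-0 (suc (suc i)) = refl

  -- Signs of the coefficients of a realizable cubic.

  realizable⇒coefficients-nonPos : ∀ {k₂ k₃} → Realizable 3 (depressedCubic k₂ k₃) →
    ∃[ p ] ∃[ q ] 0# ≤ p × 0# ≤ q × k₂ ≈ - p × k₃ ≈ - q
  realizable⇒coefficients-nonPos {k₂} {k₃} (A , 0≤A , charPoly≈) =
    cycles₂ A , cycles₃ A ,
    +-nonNeg (+-nonNeg (0≤A² 0F 1F 1F 0F) (0≤A² 0F 2F 2F 0F)) (0≤A² 1F 2F 2F 1F) ,
    +-nonNeg (*-nonNeg (0≤A² 0F 1F 1F 2F) (0≤A 2F 0F)) (*-nonNeg (0≤A² 0F 2F 1F 0F) (0≤A 2F 1F)) ,
    trans (sym (depressedCubic-coeff₁ k₂ k₃))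
      (trans (sym (charPoly≈ 1)) (trans (charPoly-coeff₁ A) diagonal-terms-vanish)) ,
    trans (sym (depressedCubic-coeff₀ k₂ k₃))
      (trans (sym (charPoly≈ 0)) (trans (charPoly-coeff₀ A) diagonal-terms-vanish))
    where
    0≤A² : ∀ i j k l → 0# ≤ A i j * A k l
    0≤A² i j k l = *-nonNeg (0≤A i j) (0≤A k l)

    trace≈0 : A 0F 0F + (A 1F 1F + A 2F 2F) ≈ 0#
    trace≈0 = trans (sym (-‿involutive _)) (trans (-‿cong
      (trans (sym (charPoly-coeff₂ A)) (trans (charPoly≈ 2) (depressedCubic-coeff₂ k₂ k₃)))) -0#≈0#)

    A₀₀≈0∧rest≈0 : A 0F 0F ≈ 0# × A 1F 1F + A 2F 2F ≈ 0#
    A₀₀≈0∧rest≈0 = nonNeg-sum≈0⇒≈0 (0≤A 0F 0F) (+-nonNeg (0≤A 1F 1F) (0≤A 2F 2F)) trace≈0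

    A₁₁≈0∧A₂₂≈0 : A 1F 1F ≈ 0# × A 2F 2F ≈ 0#
    A₁₁≈0∧A₂₂≈0 = nonNeg-sum≈0⇒≈0 (0≤A 1F 1F) (0≤A 2F 2F) (proj₂ A₀₀≈0∧rest≈0)

    -- The cofactors are arbitrary so that the linear and the constant coefficient are both
    -- instances.
    diagonal-terms-vanish : ∀ {u v w x} →
      A 0F 0F * u + A 1F 1F * v + A 2F 2F * w - x ≈ - x
    diagonal-terms-vanish {u} {v} {w} {x} = begin
      A 0F 0F * u + A 1F 1F * v + A 2F 2F * w - x
        ≈⟨ +-congʳ (+-cong (+-cong (*-congʳ (proj₁ A₀₀≈0∧rest≈0)) (*-congʳ (proj₁ A₁₁≈0∧A₂₂≈0)))
                           (*-congʳ (proj₂ A₁₁≈0∧A₂₂≈0))) ⟩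
      0# * u + 0# * v + 0# * w - x
        ≈⟨ +-congʳ (+-cong (+-cong (zeroˡ u) (zeroˡ v)) (zeroˡ w)) ⟩
      0# + 0# + 0# - x
        ≈⟨ +-congʳ (trans (+-identityʳ _) (+-identityʳ _)) ⟩
      0# - x
        ≈⟨ +-identityˡ (- x) ⟩
      - x ∎
      where open ≈-Reasoning setoid

  -- The realizing matrix.

  witness : Carrier → Carrier → Matrix Carrier 3
  -- Two 2-cycles of weight `h` share the middle vertex, and the single 3-cycle has weight `q`. Were
  -- the two entries `h` replaced by `h + h` and 0, the case `q ≈ 0#` would produce a zero row or
  -- column.
  witness h q = matrix₃ 0# 1# 0#
                        h  0# 1#
                        q  h  0#

  charPoly-witness : ∀ h q → charPoly (witness h q) P.≈ depressedCubic (- (h + h)) (- q)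
  charPoly-witness h q = λ where
      0 → solve-≈ ρ (lhs 0) (rhs 0)
      1 → solve-≈ ρ (lhs 1) (rhs 1)
      2 → solve-≈ ρ (lhs 2) (rhs 2)
      3 → solve-≈ ρ (lhs 3) (rhs 3)
      -- Both coefficient lists end at degree 3, so `coeff` returns its default `0#`.
      (suc (suc (suc (suc i)))) → refl
    where
    ρ : Vec Carrier 2
    ρ = h ∷ q ∷ []

    𝟎 𝟏 𝐡 𝐪 : Polynomial 2
    𝟎 = con (0 , 0)
    𝟏 = con (1 , 0)
    𝐡 = var 0F
    𝐪 = var 1F

    lhs rhs : ℕ → Polynomial 2
    lhs = S.coeff 2 (S.characteristic 2 (S.matrix₃ 2 𝟎 𝟏 𝟎 𝐡 𝟎 𝟏 𝐪 𝐡 𝟎))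
    rhs = S.coeff 2 (S.cubic 2 (:- (𝐡 :+ 𝐡)) (:- 𝐪))

  witness-nonNegative : ∀ {h q} → 0# ≤ h → 0# ≤ q → Nonnegative (witness h q)
  witness-nonNegative 0≤h 0≤q = λ where
      0F 0F → 0≤0 ; 0F 1F → 0≤1 ; 0F 2F → 0≤0
      1F 0F → 0≤h ; 1F 1F → 0≤0 ; 1F 2F → 0≤1
      2F 0F → 0≤q ; 2F 1F → 0≤h ; 2F 2F → 0≤0
    where
    0≤0 : 0# ≤ 0#
    0≤0 = ≤-reflexive refl

  -- Irreducibility of the realizing matrix.

  reducible⇒zeroColumn⊎zeroRow : ∀ {A : Matrix Carrier 3} (σ : Permutation′ 3) →
    BlockTriangular (permute σ A) →
    (∃[ j ] ∀ i → i ≢ j → A i j ≈ 0#) ⊎ (∃[ i ] ∀ j → j ≢ i → A i j ≈ 0#)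
  reducible⇒zeroColumn⊎zeroRow {A} σ (k , 0<k , k<3 , block) = go k 0<k k<3 block
    where
    moved : ∀ {i m} → i ≢ σ ⟨$⟩ʳ m → σ ⟨$⟩ˡ i ≢ m
    moved i≢σm ≡.refl = i≢σm (≡.sym (inverseʳ σ))

    ≢0⇒≥1 : ∀ (m : Fin 3) → m ≢ 0F → 1 ℕ.≤ toℕ m
    ≢0⇒≥1 0F      m≢0 = contradiction ≡.refl m≢0
    ≢0⇒≥1 (suc m) m≢0 = s≤s z≤n

    ≢2⇒<2 : ∀ (m : Fin 3) → m ≢ 2F → toℕ m ℕ.< 2
    ≢2⇒<2 0F m≢2 = s≤s z≤n
    ≢2⇒<2 1F m≢2 = s≤s (s≤s z≤n)
    ≢2⇒<2 2F m≢2 = contradiction ≡.refl m≢2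

    -- For `k = 1` the zero block is the off-diagonal part of column `σ ⟨$⟩ʳ 0F`, for `k = 2` that
    -- of row `σ ⟨$⟩ʳ 2F`. Each original index is looked up at its position under the inverse of
    -- `σ`.
    go : ∀ k → 0 ℕ.< k → k ℕ.< 3 →
      (∀ i j → k ℕ.≤ toℕ i → toℕ j ℕ.< k → permute σ A i j ≈ 0#) → _
    go 1 _ _ block = inj₁ (σ ⟨$⟩ʳ 0F , λ i i≢j →
      ≡.subst (λ i → A i (σ ⟨$⟩ʳ 0F) ≈ 0#) (inverseʳ σ)
        (block (σ ⟨$⟩ˡ i) 0F (≢0⇒≥1 _ (moved i≢j)) (s≤s z≤n)))
    go 2 _ _ block = inj₂ (σ ⟨$⟩ʳ 2F , λ j j≢i →
      ≡.subst (λ j → A (σ ⟨$⟩ʳ 2F) j ≈ 0#) (inverseʳ σ)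
        (block 2F (σ ⟨$⟩ˡ j) (s≤s (s≤s z≤n)) (≢2⇒<2 _ (moved j≢i))))
    go (suc (suc (suc k))) _ (s≤s (s≤s (s≤s ()))) _

  -- Columns `1F` and `2F` and rows `0F` and `1F` have an off-diagonal 1. Off the diagonal, column
  -- `0F` and row `2F` consist of `h` and `q`.
  witness-irreducible : ∀ {h q} → ¬ (h ≈ 0# × q ≈ 0#) → Irreducible (witness h q)
  witness-irreducible {h} {q} ¬[h≈0×q≈0] (σ , block)
    with reducible⇒zeroColumn⊎zeroRow {witness h q} σ block
  ... | inj₁ (0F , column≈0) = ¬[h≈0×q≈0] (column≈0 1F (λ ()) , column≈0 2F (λ ()))
  ... | inj₁ (1F , column≈0) = 0≉1 (sym (column≈0 0F (λ ())))
  ... | inj₁ (2F , column≈0) = 0≉1 (sym (column≈0 1F (λ ())))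
  ... | inj₂ (0F , row≈0)    = 0≉1 (sym (row≈0 1F (λ ())))
  ... | inj₂ (1F , row≈0)    = 0≉1 (sym (row≈0 2F (λ ())))
  ... | inj₂ (2F , row≈0)    = ¬[h≈0×q≈0] (row≈0 1F (λ ()) , row≈0 0F (λ ()))

  -- The two implications.

  realizable⇒irreduciblyRealizable : ∀ {k₂ k₃} → ¬ (depressedCubic k₂ k₃ P.≈ X ^ 3) →
    Realizable 3 (depressedCubic k₂ k₃) → IrreduciblyRealizable 3 (depressedCubic k₂ k₃)
  realizable⇒irreduciblyRealizable {k₂} {k₃} ≉X³ realizable =
    let p , q , 0≤p , 0≤q , k₂≈-p , k₃≈-q = realizable⇒coefficients-nonPos realizable
        h , 0≤h , h+h≈p                   = halve 0≤p
        -[h+h]≈k₂ = trans (-‿cong h+h≈p) (sym k₂≈-p)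
        -q≈k₃     = sym k₃≈-q
    in  witness h q , witness-nonNegative 0≤h 0≤q ,
        -- If `h` and `q` both vanished, the cubic would be the excluded `X ^ 3`.
        witness-irreducible (≉X³ ∘ vanishing -[h+h]≈k₂ -q≈k₃) ,
        ≈ᴾ-trans (charPoly (witness h q)) (depressedCubic (- (h + h)) (- q)) (depressedCubic k₂ k₃)
          (charPoly-witness h q) (depressedCubic-cong -[h+h]≈k₂ -q≈k₃)
    where
    vanishing : ∀ {h q} → - (h + h) ≈ k₂ → - q ≈ k₃ → h ≈ 0# × q ≈ 0# →
      depressedCubic k₂ k₃ P.≈ X ^ 3
    vanishing {h} {q} -[h+h]≈k₂ -q≈k₃ (h≈0 , q≈0) =
      ≈ᴾ-trans (depressedCubic k₂ k₃) (depressedCubic 0# 0#) (X ^ 3)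
        (depressedCubic-cong k₂≈0 k₃≈0) depressedCubic-0-0
      where
      k₂≈0 : k₂ ≈ 0#
      k₂≈0 = trans (sym -[h+h]≈k₂)
        (trans (-‿cong (trans (+-cong h≈0 h≈0) (+-identityˡ 0#))) -0#≈0#)

      k₃≈0 : k₃ ≈ 0#
      k₃≈0 = trans (sym -q≈k₃) (trans (-‿cong q≈0) -0#≈0#)

theorem24 : ∀ {c ℓ₁ ℓ₂} (ℝ : CompleteOrderedField c ℓ₁ ℓ₂) →
    let open Realizability ℝ in
    (k₂ k₃ : Carrier) →
    ¬ (depressedCubic k₂ k₃ P.≈ X ^ 3) →
    Realizable 3 (depressedCubic k₂ k₃) ⇔ IrreduciblyRealizable 3 (depressedCubic k₂ k₃)
theorem24 ℝ k₂ k₃ ≉X³ = mk⇔ (realizable⇒irreduciblyRealizable ℝ ≉X³)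
  λ (A , nonnegative , _ , charPoly≈) → A , nonnegative , charPoly≈
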